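{- Let $\iota\in I(n)$, let $\pi\in IP(n)$ be the corresponding idempotent permutation, and let $\gamma$ be the sequence obtained by associatively permuting $\pi$ (characteristic function defined implicitly). There is an $\mathcal{O}(n)$ time algorithm that generates the linearly ordered arrangement of $\iota$ in-place of $\gamma$ using $\log n$ bits.
   Context: $[n]=\{1,\ldots,n\}$. $I(n)$ is the set of idempotent maps $\iota:[n]\to[n]$ ($\iota(\iota(x))=\iota(x)$ for all $x$). For $\iota\in I(n)$ with fixed points $a_1<\cdots<a_k$, put $[a_i]_\iota=\{x\in[n]:\iota(x)=a_i\}$. An idempotent permutation of degree $k$ ($1\le k\le n$) is a permutation $\pi$ of $[n]$ together with a distinguished set of indices $A=\{a_1<\cdots<a_k\}\subseteq[n]$ such that the values $c_i=\pi(a_i)$ satisfy $1=c_1<c_2<\cdots<c_k$; put $c_{k+1}=n+1$ and $[a_i]_\pi=\{x\in[n]:c_i\le\pi(x)<c_{i+1}\}$. $IP(n)$ is the set of idempotent permutations of all degrees. $\pi$ corresponds to $\iota$ if $A$ is the set of fixed points of $\iota$ and $[a_i]_\pi=[a_i]_\iota$ for all $i$. Associatively permuting $\pi$, stored with the entries at indices in $A$ negated (characteristic function defined implicitly), yields the sequence $\gamma$ with $\gamma(c_i)=-a_i$ for $i=1,\ldots,k$ and $\gamma(x)=x$ for $x\in[n]\setminus\{c_1,\ldots,c_k\}$. The linearly ordered arrangement of $\iota$ is the sequence of values $\iota(1),\ldots,\iota(n)$ sorted in nondecreasing order. "In-place of $\gamma$" means that an array initially holding $\gamma$ finally holds the result.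 Computation is on a unit-cost random access machine; "$\log n$ bits" means that besides the array one auxiliary variable of $\log n$ bits (an index or value of magnitude $O(n)$) is used. -}

module Defs where

open import Algebra.Definitions using (IdempotentFun)
open import Data.Fin using (Fin; toℕ; fromℕ<)
open import Data.Fin.Permutation using (Permutation′; _⟨$⟩ʳ_)
open import Data.Fin.Properties using (any?; ≤-decTotalOrder) renaming (_≟_ to _≟ᶠ_)
open import Data.Integer using (ℤ; +_; -_; ∣_∣)
open import Data.List using (List)
import Data.List as List
import Data.List.Sort as Sort
open import Data.Nat using (ℕ; suc; _≤_; _<_; _+_; _<?_)
open import Data.Product using (∃; _×_; _,_)
open import Data.Vec using (Vec; lookup; tabulate; _[_]≔_)
open import Function.Bundles using (_⇔_)
open import Relation.Binary.PropositionalEquality using (_≡_)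
open import Relation.Nullary using (Dec; yes; no; ¬_)
import Data.Fin as Fin
import Data.Integer as ℤ

-- [n] = {1, …, n} is Fin n; the element x : Fin n stands for the number pos x.
-- The offset matters: values are stored negated, and -0 could not be told from 0.

pos : ∀ {n} → Fin n → ℕ
pos x = suc (toℕ x)

------------------------------------------------------------------------
-- Idempotent maps and idempotent permutations

record IdempotentMap (n : ℕ) : Set where
  field
    map        : Fin n → Fin n
    idempotent : IdempotentFun _≡_ map

  -- ι(1), …, ι(n) in nondecreasing order.
  arrangement : List (Fin n)
  arrangement = Sort.sort (≤-decTotalOrder n) (List.map map (List.allFin n))

-- The set A = {a₁ < ⋯ < aₖ} is given by its increasing enumeration a.

record IdempotentPermutation (n : ℕ) : Set where
  field
    perm     : Permutation′ n
    k        : ℕ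
    1≤k      : 1 ≤ k
    k≤n      : k ≤ n
    a        : Fin k → Fin n
    a-strict : ∀ {i j} → i Fin.< j → a i Fin.< a j

  c : Fin k → Fin n
  c i = perm ⟨$⟩ʳ a i

  field
    c-first  : ∀ i → pos i ≡ 1 → pos (c i) ≡ 1
    c-strict : ∀ {i j} → i Fin.< j → c i Fin.< c j

  -- c̄ j is the number c_{j+1} (the subscript j is 0-based), with c_{k+1} = n + 1.
  c̄ : ℕ → ℕ
  c̄ j with j <? k
  ... | yes j<k = pos (c (fromℕ< j<k))
  ... | no  _   = suc n

  _∈Block_ : Fin n → Fin k → Set
  x ∈Block i = c̄ (toℕ i) ≤ pos (perm ⟨$⟩ʳ x) × pos (perm ⟨$⟩ʳ x) < c̄ (suc (toℕ i))

  -- The result of associatively permuting perm, the entries at the indices in A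
  -- being negated: γ(cᵢ) = -aᵢ, and γ(x) = x for every other x.
  γ-entry : (x : Fin n) → Dec (∃ λ i → c i ≡ x) → ℤ
  γ-entry x (yes (i , _)) = - (+ pos (a i))
  γ-entry x (no _)        = + pos x

  γ : Vec ℤ n
  γ = tabulate λ x → γ-entry x (any? λ i → c i ≟ᶠ x)

record Corresponds {n} (π : IdempotentPermutation n) (ι : IdempotentMap n) : Set where
  open IdempotentPermutation π
  open IdempotentMap ι
  field
    fixedPoints : ∀ x → (∃ λ i → a i ≡ x) ⇔ (map x ≡ x)
    blocks      : ∀ i x → (x ∈Block i) ⇔ (map x ≡ a i)

------------------------------------------------------------------------
-- A unit-cost random access machine whose only storage is an array of n integers
-- and one auxiliary variable.
--
-- The arithmetic operations are addition and subtraction, so every value met while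
-- evaluating an expression of a fixed program is bounded by a constant multiple of
-- the stored values and the literals. The length n of the array may be read but not
-- changed.

data Expr : Set where
  lit  : ℤ → Expr
  len  : Expr
  aux  : Expr
  cell : Expr → Expr
  _⊕_  : Expr → Expr → Expr
  _⊖_  : Expr → Expr → Expr

infixl 8 _⊕_ _⊖_

data Test : Set where
  _≤ᵗ_ : Expr → Expr → Test
  _=ᵗ_ : Expr → Expr → Test

infix 4 _≤ᵗ_ _=ᵗ_

data Program : Set where
  skip           : Program
  aux≔_          : Expr → Program
  cell[_]≔_      : Expr → Expr → Program
  _⨟_            : Program → Program → Program
  if_then_else_  : Test → Program → Program → Program
  while_loop_    : Test → Program → Program

infixr 5 _⨟_
infixr 6 aux≔_ cell[_]≔_ if_then_else_ while_loop_

-- Every constant, memory access, arithmetic operation and comparison costs one unit.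

cost : Expr → ℕ
cost (lit _)   = 1
cost len       = 1
cost aux       = 1
cost (cell e)  = 1 + cost e
cost (e₁ ⊕ e₂) = 1 + cost e₁ + cost e₂
cost (e₁ ⊖ e₂) = 1 + cost e₁ + cost e₂

costᵗ : Test → ℕ
costᵗ (e₁ ≤ᵗ e₂) = 1 + cost e₁ + cost e₂
costᵗ (e₁ =ᵗ e₂) = 1 + cost e₁ + cost e₂

record State (n : ℕ) : Set where
  constructor ⟨_,_⟩
  field
    array     : Vec ℤ n
    auxiliary : ℤ

-- Evaluation is partial: reading outside positions 1, …, n yields no value.

infix 3 _⊢_⇓_

data _⊢_⇓_ {n} (s : State n) : Expr → ℤ → Set where
  lit : ∀ {z} → s ⊢ lit z ⇓ z
  len : s ⊢ len ⇓ + n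
  aux : s ⊢ aux ⇓ State.auxiliary s
  get : ∀ {e} (i : Fin n) → s ⊢ e ⇓ + pos i → s ⊢ cell e ⇓ lookup (State.array s) i
  add : ∀ {e₁ e₂ u v} → s ⊢ e₁ ⇓ u → s ⊢ e₂ ⇓ v → s ⊢ e₁ ⊕ e₂ ⇓ (u ℤ.+ v)
  sub : ∀ {e₁ e₂ u v} → s ⊢ e₁ ⇓ u → s ⊢ e₂ ⇓ v → s ⊢ e₁ ⊖ e₂ ⇓ (u ℤ.- v)

data True {n} (s : State n) : Test → Set where
  le : ∀ {e₁ e₂ u v} → s ⊢ e₁ ⇓ u → s ⊢ e₂ ⇓ v → u ℤ.≤ v → True s (e₁ ≤ᵗ e₂)
  eq : ∀ {e₁ e₂ u v} → s ⊢ e₁ ⇓ u → s ⊢ e₂ ⇓ v → u ≡ v → True s (e₁ =ᵗ e₂)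

data False {n} (s : State n) : Test → Set where
  ¬le : ∀ {e₁ e₂ u v} → s ⊢ e₁ ⇓ u → s ⊢ e₂ ⇓ v → ¬ (u ℤ.≤ v) → False s (e₁ ≤ᵗ e₂)
  ¬eq : ∀ {e₁ e₂ u v} → s ⊢ e₁ ⇓ u → s ⊢ e₂ ⇓ v → ¬ (u ≡ v) → False s (e₁ =ᵗ e₂)

-- Run w p s t s′: started in s, the program p halts in s′ after t time units.
-- A store is possible only if the value fits: magnitude at most n in an array cell
-- (as for the entries of γ, which are signed indices), at most w in the auxiliary
-- variable. Hence these bounds hold throughout a run, and no cell can hold more than
-- one index together with its sign.

data Run {n} (w : ℕ) : Program → State n → ℕ → State n → Set where
  skip      : ∀ {s} → Run w skip s 1 s
  set-aux   : ∀ {e α x v} → ⟨ α , x ⟩ ⊢ e ⇓ v → ∣ v ∣ ≤ w →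
              Run w (aux≔ e) ⟨ α , x ⟩ (1 + cost e) ⟨ α , v ⟩
  set-cell  : ∀ {e₁ e₂ α x v} (i : Fin n) →
              ⟨ α , x ⟩ ⊢ e₁ ⇓ + pos i → ⟨ α , x ⟩ ⊢ e₂ ⇓ v → ∣ v ∣ ≤ n →
              Run w (cell[ e₁ ]≔ e₂) ⟨ α , x ⟩ (1 + cost e₁ + cost e₂) ⟨ α [ i ]≔ v , x ⟩
  seq       : ∀ {p q s s′ s″ t t′} → Run w p s t s′ → Run w q s′ t′ s″ →
              Run w (p ⨟ q) s (t + t′) s″
  if-true   : ∀ {b p q s s′ t} → True s b → Run w p s t s′ →
              Run w (if b then p else q) s (costᵗ b + t) s′
  if-false  : ∀ {b p q s s′ t} → False s b → Run w q s t s′ →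
              Run w (if b then p else q) s (costᵗ b + t) s′
  while-end : ∀ {b p s} → False s b → Run w (while b loop p) s (costᵗ b) s
  while-do  : ∀ {b p s s′ s″ t t′} → True s b → Run w p s t s′ →
              Run w (while b loop p) s′ t′ s″ →
              Run w (while b loop p) s (costᵗ b + t + t′) s″

{-# OPTIONS --safe #-}
module Submission where

-- The linearly ordered arrangement of ι is constant on each interval
-- cᵢ, …, cᵢ₊₁ - 1, where it equals aᵢ.  Indeed the position y holds ι(π⁻¹(y)):
-- the list of these values is a rearrangement of ι(1), …, ι(n), and it is
-- nondecreasing because the blocks [aᵢ] are, in the order of i, sent by π to
-- consecutive intervals (resultAt-mono); a sorted rearrangement is unique
-- (resultAt-sorts).
--
-- In γ the left end cᵢ of each interval is marked by the negative entry -aᵢ, and all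
-- other entries are positive.  So one sweep from left to right suffices: a negative
-- entry is negated, and a positive entry is overwritten by its left neighbour, which
-- already has its final value and belongs to the same interval (γ-codes).  The first
-- entry of γ is negative, so the left neighbour always exists.  The sweep needs one
-- index, at most n + 1, and constant time for each position (sweep-run).

open import Defs
open import Data.Empty using (⊥-elim)
open import Data.Fin using (Fin; toℕ; fromℕ<)
import Data.Fin as Fin
open import Data.Fin.Permutation using (Permutation′; _⟨$⟩ʳ_; _⟨$⟩ˡ_; inverseˡ; inverseʳ)
open import Data.Fin.Properties
  using (any?; ≤-decTotalOrder; toℕ<n; toℕ-fromℕ<; fromℕ<-toℕ; toℕ-injective; toℕ-inject₁; <⇒≢)
  renaming (_≟_ to _≟ᶠ_)
open import Data.Integer as ℤ using (ℤ; +_; -_; +≤+; -≤+)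
open import Data.List as List using (map; allFin; tabulate)
open import Data.List.Membership.Propositional using (_∈_)
open import Data.List.Membership.Propositional.Properties using (∈-allFin; ∈-tabulate⁺)
open import Data.List.Membership.Propositional.Properties.WithK using (unique∧set⇒bag)
open import Data.List.Properties using (map-tabulate; tabulate-cong)
open import Data.List.Relation.Binary.BagAndSetEquality using (∼bag⇒↭)
open import Data.List.Relation.Binary.Permutation.Propositional
  using (_↭_; ↭-sym; ↭-trans; ↭⇒↭ₛ)
open import Data.List.Relation.Binary.Permutation.Propositional.Properties using (map⁺)
open import Data.List.Relation.Binary.Pointwise using (Pointwise-≡⇒≡)
import Data.List.Relation.Unary.AllPairs.Properties as AllPairs
import Data.List.Relation.Unary.Unique.Propositional.Properties as Unique
open import Data.List.Relation.Unary.Sorted.TotalOrder.Properties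
  using (AllPairs⇒Sorted; ↗↭↗⇒≋)
import Data.List.Sort as Sort
open import Data.Nat using (ℕ; zero; suc; _+_; _*_; _≤_; _<_; z≤n; s≤s; s≤s⁻¹; _<?_)
open import Data.Nat.Properties hiding (≤-decTotalOrder; <⇒≢)
open import Data.Nat.Solver using (module +-*-Solver)
open import Data.Product using (Σ; ∃; _×_; _,_; proj₁; proj₂)
open import Data.Sum using (_⊎_; inj₁; inj₂)
open import Data.Vec using (Vec; lookup; toList; _∷_; []; _[_]≔_)
open import Data.Vec.Properties using (lookup∘update; lookup∘update′; lookup∘tabulate)
open import Function using (_∘_; mk⇔; Equivalence)
open import Relation.Binary.Bundles using (module DecTotalOrder)
open import Relation.Binary.PropositionalEquality
  using (_≡_; refl; sym; trans; cong; subst; module ≡-Reasoning)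
open import Relation.Nullary using (¬_; yes; no)

open +-*-Solver using (solve; con; _:+_; _:*_; _:=_)

-- The sweep and its running time

-- γ codes r if at every position it holds either the negated value of r, or the
-- position itself, and then r repeats there the value at the position before.
Codes : ∀ {n} → Vec ℤ n → (Fin n → Fin n) → Set
Codes γ r = ∀ y → lookup γ y ≡ - (+ pos (r y))
                ⊎ lookup γ y ≡ + pos y × ∃ λ x → toℕ y ≡ suc (toℕ x) × r y ≡ r x

-- One step of the sweep: the final value is stored in the cell that aux points to.
fill : Program
fill = if cell aux ≤ᵗ lit (+ 0)
         then cell[ aux ]≔ lit (+ 0) ⊖ cell aux
         else cell[ aux ]≔ cell (aux ⊖ lit (+ 1))

-- The index aux of the cell to be filled runs up to n, and the loop ends at n + 1.
loop : Program
loop = while aux ≤ᵗ len loop (fill ⨟ aux≔ aux ⊕ lit (+ 1))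

-- The whole algorithm: the sweep starts at the first position.
sweep : Program
sweep = aux≔ lit (+ 1) ⨟ loop

-- The invariant of the sweep: α is γ with the first j positions filled by r.
record Swept {n} (γ : Vec ℤ n) (r : Fin n → Fin n) (j : ℕ) (α : Vec ℤ n) : Set where
  field
    filled    : ∀ y → toℕ y < j → lookup α y ≡ + pos (r y)
    untouched : ∀ y → j ≤ toℕ y → lookup α y ≡ lookup γ y

module _ {n} {γ : Vec ℤ n} {r : Fin n → Fin n} (codes : Codes γ r) (w : ℕ) where

  Swept-step : ∀ {α} y → Swept γ r (toℕ y) α →
               Swept γ r (suc (toℕ y)) (α [ y ]≔ + pos (r y))
  Swept-step {α} y swept = record
    { filled    = λ x x≤y → filled′ x (m≤n⇒m<n∨m≡n (s≤s⁻¹ x≤y))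
    ; untouched = λ x y<x → trans (lookup∘update′ (<⇒≢ y<x ∘ sym) α _)
                                  (untouched x (<⇒≤ y<x))
    }
    where
    open Swept swept
    filled′ : ∀ x → toℕ x < toℕ y ⊎ toℕ x ≡ toℕ y →
              lookup (α [ y ]≔ + pos (r y)) x ≡ + pos (r x)
    filled′ x (inj₁ x<y) = trans (lookup∘update′ (<⇒≢ x<y) α _) (filled x x<y)
    filled′ x (inj₂ x≡y) with refl ← toℕ-injective x≡y = lookup∘update y α _

  -- Assigning to the current cell any expression with the right value.
  store : ∀ {e α y v} → ⟨ α , + pos y ⟩ ⊢ e ⇓ v → v ≡ + pos (r y) →
          Run w (cell[ aux ]≔ e) ⟨ α , + pos y ⟩ (2 + cost e)
            ⟨ α [ y ]≔ + pos (r y) , + pos y ⟩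
  store {y = y} e⇓ refl = set-cell y aux e⇓ (toℕ<n (r y))

  fill-run : ∀ {α} y → Swept γ r (toℕ y) α →
             Run w fill ⟨ α , + pos y ⟩ 10 ⟨ α [ y ]≔ + pos (r y) , + pos y ⟩
  fill-run {α} y swept with codes y
  ... | inj₁ γy≡-r =
    if-true (le (get y aux) lit (subst (ℤ._≤ + 0) (sym αy≡-r) -≤+))
            (store (sub lit (get y aux)) (cong (λ v → + 0 ℤ.- v) αy≡-r))
    where
    αy≡-r : lookup α y ≡ - (+ pos (r y))
    αy≡-r = trans (Swept.untouched swept y ≤-refl) γy≡-r
  ... | inj₂ (γy≡y , x , y≡1+x , ry≡rx) =
    if-false (¬le (get y aux) lit (positive ∘ subst (ℤ._≤ + 0) αy≡y))
             (store (get x (left y≡1+x)) (trans (filled x (≤-reflexive (sym y≡1+x)))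
                                                (cong (λ z → + pos z) (sym ry≡rx))))
    where
    open Swept swept
    αy≡y : lookup α y ≡ + pos y
    αy≡y = trans (untouched y ≤-refl) γy≡y
    positive : ¬ (+ pos y ℤ.≤ + 0)
    positive (+≤+ ())
    left : ∀ {j} → j ≡ suc (toℕ x) → ⟨ α , + suc j ⟩ ⊢ aux ⊖ lit (+ 1) ⇓ + pos x
    left refl = sub aux lit

  increment-run : ∀ {α : Vec ℤ n} j → suc (suc j) ≤ w →
                  Run w (aux≔ aux ⊕ lit (+ 1)) ⟨ α , + suc j ⟩ 4 ⟨ α , + suc (suc j) ⟩
  increment-run {α} j =
    subst (λ k → k ≤ w → Run w (aux≔ aux ⊕ lit (+ 1)) ⟨ α , + suc j ⟩ 4 ⟨ α , + k ⟩)
          (+-comm (suc j) 1) (set-aux (add aux lit))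

  -- Each of the m remaining positions takes 3 + 10 + 4 steps, and the last test 3.
  loop-run : suc n ≤ w → ∀ m j {α} → m + j ≡ n → Swept γ r j α →
             ∃ λ s → Run w loop ⟨ α , + suc j ⟩ (m * 17 + 3) s × Swept γ r n (State.array s)
  loop-run n<w zero j refl swept =
    _ , while-end (¬le aux len λ { (+≤+ n<n) → <-irrefl refl n<n }) , swept
  loop-run n<w (suc m) j 1+m+j≡n swept with fin (subst (j <_) 1+m+j≡n (s≤s (m≤n+m j m)))
    where
    fin : ∀ {j} → j < n → ∃ λ (y : Fin n) → j ≡ toℕ y
    fin j<n = fromℕ< j<n , sym (toℕ-fromℕ< j<n)
  ... | y , refl
    with s , run , done ← loop-run n<w m (suc (toℕ y)) (trans (+-suc m _) 1+m+j≡n)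
                                   (Swept-step y swept)
    = s
    , while-do (le aux len (+≤+ (toℕ<n y)))
               (seq (fill-run y swept)
                    (increment-run (toℕ y) (≤-trans (s≤s (toℕ<n y)) n<w)))
               run
    , done

  Swept-start : Swept γ r 0 γ
  Swept-start = record { filled = λ _ () ; untouched = λ _ _ → refl }

  sweep-run : suc n ≤ w →
              ∃ λ s → Run w sweep ⟨ γ , + 0 ⟩ (2 + (n * 17 + 3)) s
                    × (∀ y → lookup (State.array s) y ≡ + pos (r y))
  sweep-run n<w with s , run , done ← loop-run n<w n 0 (+-comm n 0) Swept-start
    = s , seq (set-aux lit (≤-trans (s≤s z≤n) n<w)) run , λ y → Swept.filled done y (toℕ<n y)

-- The sorted arrangement of an idempotent map

-- Both lists are duplicate-free and contain every element of [n].
tabulate-↭ : ∀ {n} (ρ : Permutation′ n) → tabulate (ρ ⟨$⟩ˡ_) ↭ allFin n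
tabulate-↭ {n} ρ = ∼bag⇒↭ (unique∧set⇒bag
  (Unique.tabulate⁺ λ {x} {y} ρx≡ρy →
    trans (sym (inverseʳ ρ)) (trans (cong (ρ ⟨$⟩ʳ_) ρx≡ρy) (inverseʳ ρ)))
  (Unique.allFin⁺ n)
  (mk⇔ (λ _ → ∈-allFin _)
       (λ _ → subst (_∈ tabulate (ρ ⟨$⟩ˡ_)) (inverseˡ ρ) (∈-tabulate⁺ (ρ ⟨$⟩ʳ _)))))

toList-lookup : ∀ {A : Set} {n} (xs : Vec A n) → toList xs ≡ tabulate (lookup xs)
toList-lookup []       = refl
toList-lookup (x ∷ xs) = cong (x List.∷_) (toList-lookup xs)

-- Any element below y, not necessarily the one before it, shows that y is not the
-- first element.
predecessor : ∀ {n} {z y : Fin n} → z Fin.< y → ∃ λ (x : Fin n) → toℕ y ≡ suc (toℕ x)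
predecessor {y = Fin.suc y} _ = Fin.inject₁ y , cong suc (sym (toℕ-inject₁ y))

strict⇒mono : ∀ {m n} {f : Fin m → Fin n} → (∀ {i j} → i Fin.< j → f i Fin.< f j) →
              ∀ {i j} → i Fin.≤ j → f i Fin.≤ f j
strict⇒mono f-strict i≤j with m≤n⇒m<n∨m≡n i≤j
... | inj₁ i<j = <⇒≤ (f-strict i<j)
... | inj₂ i≡j with refl ← toℕ-injective i≡j = ≤-refl

module _ {n} (ι : IdempotentMap n) (π : IdempotentPermutation n) (corr : Corresponds π ι) where
  open IdempotentMap ι renaming (map to ι̂)
  open IdempotentPermutation π
  open Corresponds corr

  -- The value ι(π⁻¹(y)), which the arrangement of ι has at the position y.
  resultAt : Fin n → Fin n
  resultAt y = ι̂ (perm ⟨$⟩ˡ y)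

  -- y lies in the interval cᵢ, …, cᵢ₊₁ - 1, the image of the block [aᵢ] under π.
  _∈Interval_ : Fin n → Fin k → Set
  y ∈Interval i = c̄ (toℕ i) ≤ pos y × pos y < c̄ (suc (toℕ i))

  interval⇒resultAt : ∀ {i y} → y ∈Interval i → resultAt y ≡ a i
  interval⇒resultAt {i} {y} y∈i = Equivalence.to (blocks i (perm ⟨$⟩ˡ y))
    (subst (_∈Interval i) (sym (inverseʳ perm)) y∈i)

  -- ι(π⁻¹(y)) is a fixed point of ι, hence some aᵢ.
  intervalOf : ∀ y → ∃ λ i → y ∈Interval i
  intervalOf y
    with i , ai≡ ← Equivalence.from (fixedPoints (resultAt y)) (idempotent (perm ⟨$⟩ˡ y))
    = i , subst (_∈Interval i) (inverseʳ perm)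
                (Equivalence.from (blocks i (perm ⟨$⟩ˡ y)) (sym ai≡))

  c̄-toℕ : ∀ i → c̄ (toℕ i) ≡ pos (c i)
  c̄-toℕ i with toℕ i <? k
  ... | yes i<k = cong (pos ∘ c) (fromℕ<-toℕ i i<k)
  ... | no  i≮k = ⊥-elim (i≮k (toℕ<n i))

  -- An interval ends before any later interval begins.
  c̄-suc : ∀ {i j : Fin k} → i Fin.< j → c̄ (suc (toℕ i)) ≤ pos (c j)
  c̄-suc {i} {j} i<j with suc (toℕ i) <? k
  ... | yes 1+i<k = s≤s (strict⇒mono c-strict (subst (_≤ toℕ j) (sym (toℕ-fromℕ< 1+i<k)) i<j))
  ... | no  1+i≮k = ⊥-elim (1+i≮k (≤-<-trans i<j (toℕ<n j)))

  resultAt-mono : ∀ {x y} → x Fin.< y → resultAt x Fin.≤ resultAt y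
  resultAt-mono {x} {y} x<y
    with i , x∈i@(ci≤x , _) ← intervalOf x | j , y∈j@(_ , y<cj+1) ← intervalOf y
    rewrite interval⇒resultAt x∈i | interval⇒resultAt y∈j
    = strict⇒mono a-strict (≮⇒≥ λ j<i → <-irrefl refl (begin-strict
        pos x             <⟨ s≤s x<y ⟩
        pos y             <⟨ y<cj+1 ⟩
        c̄ (suc (toℕ j))   ≤⟨ c̄-suc j<i ⟩
        pos (c i)         ≡⟨ c̄-toℕ i ⟨
        c̄ (toℕ i)         ≤⟨ ci≤x ⟩
        pos x             ∎))
    where open ≤-Reasoning

  resultAt-sorts : tabulate resultAt ≡ arrangement
  resultAt-sorts = Pointwise-≡⇒≡ (↗↭↗⇒≋ totalOrder
    (AllPairs⇒Sorted totalOrder (AllPairs.tabulate⁺-< resultAt-mono))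
    (sort-↗ _)
    (↭⇒↭ₛ (↭-trans resultAt-↭ (↭-sym (sort-↭ _)))))
    where
    open Sort (≤-decTotalOrder n)
    open DecTotalOrder (≤-decTotalOrder n) using (totalOrder)
    resultAt-↭ : tabulate resultAt ↭ map ι̂ (allFin n)
    resultAt-↭ = subst (_↭ map ι̂ (allFin n)) (map-tabulate (perm ⟨$⟩ˡ_) ι̂)
                       (map⁺ ι̂ (tabulate-↭ perm))

  -- If y is not a left end, its interval starts strictly before y, and so contains
  -- the position before y.
  resultAt-pred : ∀ y → ¬ (∃ λ i → c i ≡ y) →
                  ∃ λ x → toℕ y ≡ suc (toℕ x) × resultAt y ≡ resultAt x
  resultAt-pred y y∉c with i , y∈i@(ci≤y , y<ci+1) ← intervalOf y
    = x , y≡1+x , trans (interval⇒resultAt y∈i) (sym (interval⇒resultAt x∈i))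
    where
    ci<y : c i Fin.< y
    ci<y = ≤∧≢⇒< (s≤s⁻¹ (subst (_≤ pos y) (c̄-toℕ i) ci≤y)) λ ci≡y → y∉c (i , toℕ-injective ci≡y)
    x = proj₁ (predecessor ci<y)
    y≡1+x = proj₂ (predecessor ci<y)
    x∈i : x ∈Interval i
    x∈i = subst (_≤ pos x) (sym (c̄-toℕ i)) (subst (toℕ (c i) <_) y≡1+x ci<y)
        , <-trans (subst (pos x <_) (cong suc (sym y≡1+x)) ≤-refl) y<ci+1

  γ-codes : Codes γ resultAt
  γ-codes y rewrite lookup∘tabulate (λ x → γ-entry x (any? λ i → c i ≟ᶠ x)) y
    with any? (λ i → c i ≟ᶠ y)
  ... | yes (i , refl) = inj₁ (cong (λ z → - (+ pos z)) (sym resultAt-c))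
    where
    resultAt-c : resultAt (c i) ≡ a i
    resultAt-c = trans (cong ι̂ (inverseˡ perm)) (Equivalence.to (fixedPoints (a i)) (i , refl))
  ... | no y∉c = inj₂ (refl , resultAt-pred y y∉c)

theorem3p23 : Σ Program λ p → Σ ℕ λ C → Σ ℕ λ D →
    ∀ (n : ℕ) (ι : IdempotentMap n) (π : IdempotentPermutation n) → Corresponds π ι →
    Σ ℕ λ t → Σ (State n) λ s →
    Run (D * n) p ⟨ IdempotentPermutation.γ π , + 0 ⟩ t s
    × t ≤ C * n
    × toList (State.array s) ≡ map (λ x → + pos x) (IdempotentMap.arrangement ι)
-- As 1 ≤ k ≤ n, the additive constant 5 of the running time is at most 5 n, and the
-- final index n + 1 is at most 2 n.
theorem3p23 = sweep , 22 , 2 , λ n ι π corr →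
  let open IdempotentPermutation π using (1≤k; k≤n)
      open ≤-Reasoning
      1≤n = ≤-trans 1≤k k≤n
      n<2n = begin-strict
        n            <⟨ +-monoˡ-≤ n 1≤n ⟩
        n + n        ≡⟨ cong (_+_ n) (+-comm 0 n) ⟩
        2 * n        ∎
      time = begin
        2 + (n * 17 + 3)   ≡⟨ solve 1 (λ n → con 2 :+ (n :* con 17 :+ con 3)
                                          := con 17 :* n :+ con 5 :* con 1) refl n ⟩
        17 * n + 5 * 1     ≤⟨ +-monoʳ-≤ (17 * n) (*-monoʳ-≤ 5 1≤n) ⟩
        17 * n + 5 * n     ≡⟨ *-distribʳ-+ n 17 5 ⟨
        22 * n             ∎
      s , run , final = sweep-run (γ-codes ι π corr) (2 * n) n<2n
  in _ , s , run , time , listing ι π corr (State.array s) final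
  where
  listing : ∀ {n} ι π corr (α : Vec ℤ n) → (∀ y → lookup α y ≡ + pos (resultAt ι π corr y)) →
            toList α ≡ map (λ x → + pos x) (IdempotentMap.arrangement ι)
  listing ι π corr α final = begin
    toList α                                        ≡⟨ toList-lookup α ⟩
    tabulate (lookup α)                             ≡⟨ tabulate-cong final ⟩
    tabulate ((λ x → + pos x) ∘ resultAt ι π corr)  ≡⟨ map-tabulate _ _ ⟨
    map (λ x → + pos x) (tabulate (resultAt ι π corr))
      ≡⟨ cong (map _) (resultAt-sorts ι π corr) ⟩
    map (λ x → + pos x) (IdempotentMap.arrangement ι) ∎
    where open ≡-Reasoning
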